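{- Let $D$ be a diagonal rectangulation of size $n$, let $P$ be its adjacency poset, and let $x,y\in[n]$. Then $x\lessdot_P y$ if and only if rectangles $x$ and $y$ of $D$ form one of the following six configurations: (i) the upper-left corner of rectangle $x$ equals the lower-left corner of rectangle $y$, and the right side of rectangle $y$ lies strictly to the left of the (vertical line containing the) right side of rectangle $x$; (ii) the lower-right corner of rectangle $x$ equals the lower-left corner of rectangle $y$, and the top side of rectangle $y$ lies strictly below the (horizontal line containing the) top side of rectangle $x$; (iii) the top side of rectangle $x$ equals the bottom side of rectangle $y$; (iv) the right side of rectangle $x$ equals the left side of rectangle $y$; (v) the upper-right corner of rectangle $x$ equals the lower-right corner of rectangle $y$, and the left side of rectangle $x$ lies strictly to the right of the (vertical line containing the) left side of rectangle $y$; (vi) the upper-right corner of rectangle $x$ equals the upper-left corner of rectangle $y$, and the bottom side of rectangle $x$ lies strictly above the (horizontal line containing the) bottom side of rectangle $y$.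
   Context: **Diagonal rectangulations.** A diagonal rectangulation of size $n$ is a decomposition of the square $S=[0,n]\times[0,n]$ into $n$ axis-parallel rectangles such that the diagonal of $S$ from $(0,n)$ to $(n,0)$ contains an interior point of every rectangle and the edges of the decomposition meet this diagonal exactly in the equally spaced points $(i,n-i)$, $0\le i\le n$. The rectangles are labeled $1,\dots,n$ in the order in which they appear along the diagonal starting from the top-left corner; the one labeled $i$ is called rectangle $i$. **Adjacency poset.** The adjacency poset of a diagonal rectangulation of size $n$ is the poset on $[n]=\{1,\dots,n\}$ obtained by declaring $x<y$ whenever the interior of the bottom or left side of rectangle $y$ intersects the interior of the top or right side of rectangle $x$, and then taking the reflexive and transitive closure (these relations are acyclic, so this is a partial order). $x\lessdot_P y$ means $x<_P y$ and there is no $z$ with $x<_P z<_P y$. -}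

module Defs where

open import Algebra.Bundles using (CommutativeRing)
open import Algebra.Structures using (IsCommutativeRing)
import Algebra.Definitions.RawMonoid as RawMonoidDefs
open import Data.Fin.Base as Fin using (Fin; toℕ)
open import Data.Nat.Base using (ℕ; suc)
open import Data.Product.Base using (_×_; _,_; proj₁; ∃-syntax)
open import Level using (Level; _⊔_) renaming (suc to lsuc)
open import Relation.Binary.Core using (Rel)
open import Relation.Binary.Structures using (IsStrictTotalOrder)
import Relation.Binary.Construct.StrictToNonStrict as ToNonStrict
import Relation.Binary.Construct.NonStrictToStrict as ToStrict
open import Relation.Binary.Construct.Closure.ReflexiveTransitive using (Star)
open import Relation.Binary.PropositionalEquality using (_≡_; _≢_)
open import Relation.Nullary using (¬_)
open import Relation.Unary using (Pred; _∈_; _∩_; _∪_; _≐_; _≬_; ⋃)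

-- The plane is K × K for an arbitrary ordered field K.  The classical
-- real numbers are one such field; nothing below depends on completeness.
-- In particular corners of rectangles are not assumed to have integer
-- coordinates.

record OrderedField (c ℓ : Level) : Set (lsuc (c ⊔ ℓ)) where
  infix  4 _<_
  infixl 6 _+_
  infixl 7 _*_
  infix  8 -_
  field
    Carrier            : Set c
    _<_                : Rel Carrier ℓ
    _+_ _*_            : Carrier → Carrier → Carrier
    -_                 : Carrier → Carrier
    0# 1#              : Carrier
    isCommutativeRing  : IsCommutativeRing _≡_ _+_ _*_ -_ 0# 1#
    0≢1                : 0# ≢ 1#
    inverse            : ∀ x → x ≢ 0# → ∃[ y ] x * y ≡ 1#
    isStrictTotalOrder : IsStrictTotalOrder _≡_ _<_
    +-monoʳ-<          : ∀ x {y z} → y < z → x + y < x + z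
    *-pos              : ∀ {x y} → 0# < x → 0# < y → 0# < x * y

  commutativeRing : CommutativeRing c c
  commutativeRing = record { isCommutativeRing = isCommutativeRing }

  open CommutativeRing commutativeRing public using (_-_; +-rawMonoid)

  infix 4 _≤_
  _≤_ : Rel Carrier (c ⊔ ℓ)
  _≤_ = ToNonStrict._≤_ _≡_ _<_

  fromℕ : ℕ → Carrier
  fromℕ n = RawMonoidDefs._×_ +-rawMonoid n 1#

module Plane {c ℓ : Level} (K : OrderedField c ℓ) where
  open OrderedField K

  Point : Set c
  Point = Carrier × Carrier

  Region : Set (lsuc (c ⊔ ℓ))
  Region = Pred Point (c ⊔ ℓ)

  record Rectangle : Set (c ⊔ ℓ) where
    field
      left right bottom top : Carrier
      left<right            : left < right
      bottom<top            : bottom < top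

  open Rectangle public

  lowerLeft lowerRight upperLeft upperRight : Rectangle → Point
  lowerLeft  R = left  R , bottom R
  lowerRight R = right R , bottom R
  upperLeft  R = left  R , top R
  upperRight R = right R , top R

  closed : Rectangle → Region
  closed R (a , b) = (left R ≤ a × a ≤ right R) × (bottom R ≤ b × b ≤ top R)

  interior : Rectangle → Pred Point ℓ
  interior R (a , b) = (left R < a × a < right R) × (bottom R < b × b < top R)

  leftSide rightSide bottomSide topSide : Rectangle → Region
  leftSide   R (a , b) = a ≡ left R   × (bottom R ≤ b × b ≤ top R)
  rightSide  R (a , b) = a ≡ right R  × (bottom R ≤ b × b ≤ top R)
  bottomSide R (a , b) = b ≡ bottom R × (left R ≤ a × a ≤ right R)
  topSide    R (a , b) = b ≡ top R    × (left R ≤ a × a ≤ right R)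

  -- The relative interiors of the four sides, i.e. without the corners.
  leftSide° rightSide° bottomSide° topSide° : Rectangle → Region
  leftSide°   R (a , b) = a ≡ left R   × (bottom R < b × b < top R)
  rightSide°  R (a , b) = a ≡ right R  × (bottom R < b × b < top R)
  bottomSide° R (a , b) = b ≡ bottom R × (left R < a × a < right R)
  topSide°    R (a , b) = b ≡ top R    × (left R < a × a < right R)

  boundary : Rectangle → Region
  boundary R = leftSide R ∪ rightSide R ∪ bottomSide R ∪ topSide R

  square : ℕ → Region
  square n (a , b) = (0# ≤ a × a ≤ fromℕ n) × (0# ≤ b × b ≤ fromℕ n)

  -- The segment from (0 , n) to (n , 0).
  diagonal : ℕ → Region
  diagonal n = square n ∩ λ (a , b) → a + b ≡ fromℕ n

  -- The points (i , n - i) with 0 ≤ i ≤ n.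
  diagonalPoints : ℕ → Pred Point c
  diagonalPoints n p =
    ∃[ i ] p ≡ (fromℕ (toℕ {suc n} i) , fromℕ n - fromℕ (toℕ i))

  -- The label k ∈ {1, …, n} is represented by the element k - 1 of Fin n.
  record DiagonalRectangulation (n : ℕ) : Set (c ⊔ ℓ) where
    field
      rect             : Fin n → Rectangle
      covers           : ⋃ (Fin n) (λ i → closed (rect i)) ≐ square n
      interiorDisjoint : ∀ {i j} → i ≢ j →
                         ¬ (interior (rect i) ≬ interior (rect j))
      meetsDiagonal    : ∀ i → diagonal n ≬ interior (rect i)
      edges∩diagonal   : (⋃ (Fin n) (λ i → boundary (rect i)) ∩ diagonal n)
                         ≐ diagonalPoints n
      -- Labels increase along the diagonal from the top-left corner, that
      -- is, in the direction of increasing first coordinate.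
      labelOrder       : ∀ {i j} → i Fin.< j → ∀ {p q} →
                         p ∈ diagonal n ∩ interior (rect i) →
                         q ∈ diagonal n ∩ interior (rect j) →
                         proj₁ p < proj₁ q

  module AdjacencyPoset {n : ℕ} (D : DiagonalRectangulation n) where
    open DiagonalRectangulation D

    Adjacent : Rel (Fin n) (c ⊔ ℓ)
    Adjacent x y = (bottomSide° (rect y) ∪ leftSide° (rect y))
                   ≬ (topSide° (rect x) ∪ rightSide° (rect x))

    infix 4 _≤ₚ_ _<ₚ_ _⋖ₚ_

    _≤ₚ_ : Rel (Fin n) (c ⊔ ℓ)
    _≤ₚ_ = Star Adjacent

    _<ₚ_ : Rel (Fin n) (c ⊔ ℓ)
    _<ₚ_ = ToStrict._<_ _≡_ _≤ₚ_

    _⋖ₚ_ : Rel (Fin n) (c ⊔ ℓ)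
    x ⋖ₚ y = x <ₚ y × ¬ (∃[ z ] (x <ₚ z × z <ₚ y))

{-# OPTIONS --safe #-}
-- Write x → y when y lies to the right of x or above x with overlapping
-- projections.  No rectangle lies entirely to the upper right of another one,
-- because each of them meets the diagonal in its interior.  Hence if y is to
-- the right of x and z is above y, then already x → z directly, so every
-- path of → can be shortened to one going only right or only up; in
-- particular → is acyclic.  Let y sit on top of x.  If y does not extend
-- further right than x, every lower neighbour of y other than x precedes x; if
-- y extends at least as far left as x, every upper neighbour of x other than y
-- succeeds y; so then nothing fits in between.  If one of these two conditions
-- fails, a rectangle at the corner concerned lies in between.  If both hold
-- strictly, the rectangles at the two ends of the contact lie to the upper
-- right of one another, so this does not occur.  Horizontal adjacency follows
-- by transposing the picture.
module Submission where

open import Defs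
open import Algebra.Bundles using (CommutativeRing)
open import Data.Fin.Base as Fin using (Fin)
open import Data.Fin.Properties using () renaming (_≟_ to _≟ᶠ_)
open import Data.Empty using (⊥; ⊥-elim)
open import Data.Nat.Base using (ℕ; zero; suc)
open import Data.Product.Base using (_×_; _,_; proj₁; proj₂; ∃-syntax)
open import Data.Sum.Base using (_⊎_; inj₁; inj₂; swap) renaming (map to map⊎)
open import Function.Base using (_∘_; flip)
open import Function.Bundles using (_⇔_; mk⇔)
open import Level using (Level; _⊔_)
open import Relation.Binary.Core using (Rel)
open import Relation.Binary.Definitions using (tri<; tri≈; tri>)
open import Relation.Binary.Structures using (IsStrictTotalOrder)
open import Relation.Binary.Construct.Closure.ReflexiveTransitive using (Star; ε; _◅_; _◅◅_)
open import Relation.Binary.Construct.Closure.Transitive using (TransClosure; [_]; _∷_; _++_)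
import Relation.Binary.Construct.Flip.EqAndOrd as Flip
open import Relation.Binary.PropositionalEquality
  using (_≡_; _≢_; refl; sym; trans; cong; cong₂; subst; subst₂; module ≡-Reasoning)
open import Relation.Nullary using (¬_; yes; no)
open import Relation.Unary using (_≐_; _∈_)

-- Dense linear orders

record IsDenseOrder {a ℓ} {A : Set a} (_<_ : Rel A ℓ) : Set (a ⊔ ℓ) where
  field
    isStrictTotalOrder : IsStrictTotalOrder _≡_ _<_
    dense              : ∀ {x y} → x < y → ∃[ z ] (x < z × z < y)

  open IsStrictTotalOrder isStrictTotalOrder public
    using (compare; irrefl; asym; _<?_) renaming (trans to <-trans)

  infix 4 _≤_
  -- Unlike _<_ ⊎ _≡_, this form is definitionally reversed by flipping _<_.
  _≤_ : Rel A ℓ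
  x ≤ y = ¬ y < x

  <⇒≤ : ∀ {x y} → x < y → x ≤ y
  <⇒≤ = asym

  ≤-reflexive : ∀ {x y} → x ≡ y → x ≤ y
  ≤-reflexive x≡y = irrefl (sym x≡y)

  ≤⇒<⊎≡ : ∀ {x y} → x ≤ y → x < y ⊎ x ≡ y
  ≤⇒<⊎≡ {x} {y} x≤y with compare x y
  ... | tri< x<y _ _ = inj₁ x<y
  ... | tri≈ _ x≡y _ = inj₂ x≡y
  ... | tri> _ _ y<x = ⊥-elim (x≤y y<x)

  ≤-antisym : ∀ {x y} → x ≤ y → y ≤ x → x ≡ y
  ≤-antisym x≤y y≤x with ≤⇒<⊎≡ x≤y
  ... | inj₁ x<y = ⊥-elim (y≤x x<y)
  ... | inj₂ x≡y = x≡y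

  <-≤-trans : ∀ {x y z} → x < y → y ≤ z → x < z
  <-≤-trans x<y y≤z with ≤⇒<⊎≡ y≤z
  ... | inj₁ y<z  = <-trans x<y y<z
  ... | inj₂ refl = x<y

  ≤-<-trans : ∀ {x y z} → x ≤ y → y < z → x < z
  ≤-<-trans x≤y y<z with ≤⇒<⊎≡ x≤y
  ... | inj₁ x<y  = <-trans x<y y<z
  ... | inj₂ refl = y<z

  ≤-trans : ∀ {x y z} → x ≤ y → y ≤ z → x ≤ z
  ≤-trans x≤y y≤z z<x = y≤z (<-≤-trans z<x x≤y)

  -- The four cases select the larger left end and the smaller right end; density gives a point
  -- between these two.
  intervals-meet : ∀ {l r l′ r′} → l < r → l′ < r′ → l < r′ → l′ < r →
                   ∃[ m ] ((l < m × m < r) × (l′ < m × m < r′))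
  intervals-meet {l} {r} {l′} {r′} l<r l′<r′ l<r′ l′<r with l <? l′ | r <? r′
  ... | yes l<l′ | yes r<r′ = let m , p , q = dense l′<r in m , (<-trans l<l′ p , q) , (p , <-trans q r<r′)
  ... | yes l<l′ | no  r′≤r = let m , p , q = dense l′<r′ in m , (<-trans l<l′ p , <-≤-trans q r′≤r) , (p , q)
  ... | no  l′≤l | yes r<r′ = let m , p , q = dense l<r in m , (p , q) , (≤-<-trans l′≤l p , <-trans q r<r′)
  ... | no  l′≤l | no  r′≤r = let m , p , q = dense l<r′ in m , (p , <-≤-trans q r′≤r) , (≤-<-trans l′≤l p , q)

  -- A point just before `c`: no value of `f` lies in the half-open interval from `d` to `c`. Only a
  -- value inside that interval forces `d` to move, and moving it closer to `c` keeps the earlier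
  -- values avoided.
  approach : ∀ {m} (f : Fin m → A) {a c} → a < c →
             ∃[ d ] (a < d × d < c × (∀ i → d ≤ f i → c ≤ f i))
  approach {zero} f a<c =
    let d , a<d , d<c = dense a<c in d , a<d , d<c , λ ()
  approach {suc m} f {c = c} a<c with approach (f ∘ Fin.suc) a<c
  ... | d , a<d , d<c , avoids with f Fin.zero <? d | f Fin.zero <? c
  ...   | yes f0<d | _        = d , a<d , d<c ,
          λ { Fin.zero d≤f0 → ⊥-elim (d≤f0 f0<d) ; (Fin.suc i) → avoids i }
  ...   | no  _    | no  c≤f0 = d , a<d , d<c ,
          λ { Fin.zero _ → c≤f0 ; (Fin.suc i) → avoids i }
  ...   | no  d≤f0 | yes f0<c with dense f0<c
  ...     | e , f0<e , e<c = e , <-trans a<d d<e , e<c ,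
            λ { Fin.zero e≤f0 → ⊥-elim (e≤f0 f0<e)
              ; (Fin.suc i) e≤fi → avoids i (≤-trans (<⇒≤ d<e) e≤fi) }
            where d<e = ≤-<-trans d≤f0 f0<e

flipped : ∀ {a ℓ} {A : Set a} {_<_ : Rel A ℓ} → IsDenseOrder _<_ → IsDenseOrder (flip _<_)
flipped O = record
  { isStrictTotalOrder = Flip.isStrictTotalOrder O.isStrictTotalOrder
  ; dense              = λ y<x → let z , y<z , z<x = O.dense y<x in z , z<x , y<z
  } where module O = IsDenseOrder O

-- The order-theoretic content of a diagonal rectangulation.  It is stable
-- under exchanging the coordinates (transpose) and under half-turns (rotate).
record Tiling {a ℓ} {A : Set a} (_<_ : Rel A ℓ) (n : ℕ) : Set (a ⊔ ℓ) where
  field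
    isDenseOrder : IsDenseOrder _<_

  open IsDenseOrder isDenseOrder public

  field
    left right bottom top : Fin n → A
    left<right            : ∀ i → left i < right i
    bottom<top            : ∀ i → bottom i < top i
    separated             : ∀ {i j} → left i < right j → left j < right i →
                            bottom i < top j → bottom j < top i → i ≡ j
    -- The ambient square is expressed through edges: coordinates between edges of rectangles are
    -- coordinates inside it. The four bounding rectangles may differ.
    covered               : ∀ {i j k m u v} → left i ≤ u → u ≤ right j → bottom k ≤ v → v ≤ top m →
                            ∃[ z ] ((left z ≤ u × u ≤ right z) × (bottom z ≤ v × v ≤ top z))
    noneUpperRight        : ∀ {i j} → right i ≤ left j → top i ≤ bottom j → ⊥

  Right Up Step : Rel (Fin n) ℓ
  Right x y = right x ≤ left y × bottom x < top y × bottom y < top x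
  Up    x y = top x ≤ bottom y × left x < right y × left y < right x
  Step  x y = Right x y ⊎ Up x y

  Right⁺ Up⁺ Step⁺ Step* : Rel (Fin n) ℓ
  Right⁺ = TransClosure Right
  Up⁺    = TransClosure Up
  Step⁺  = TransClosure Step
  Step*  = Star Step

  RightTouch UpTouch Touch : Rel (Fin n) (a ⊔ ℓ)
  RightTouch x y = Right x y × right x ≡ left y
  UpTouch    x y = Up x y × top x ≡ bottom y
  Touch      x y = RightTouch x y ⊎ UpTouch x y

  -- Together with contact, `RightAligned` unites configurations (ii), (iv), (vi) and `UpAligned`
  -- unites (i), (iii), (v).
  RightAligned UpAligned : Rel (Fin n) (a ⊔ ℓ)
  RightAligned x y = (bottom y ≤ bottom x × top y ≤ top x) × (bottom x ≡ bottom y ⊎ top x ≡ top y)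
  UpAligned    x y = (left y ≤ left x × right y ≤ right x) × (left x ≡ left y ⊎ right x ≡ right y)

-- Symmetries of a tiling

module _ {a ℓ} {A : Set a} {_<_ : Rel A ℓ} {n : ℕ} where

  transpose : Tiling _<_ n → Tiling _<_ n
  transpose T = record
    { isDenseOrder = isDenseOrder
    ; left = bottom ; right = top ; bottom = left ; top = right
    ; left<right = bottom<top ; bottom<top = left<right
    ; separated = λ p q r s → separated r s p q
    ; covered = λ p q r s → let z , h , v = covered r s p q in z , v , h
    ; noneUpperRight = λ p q → noneUpperRight q p
    } where open Tiling T

  -- Reversing the order replaces negation of coordinates. A step of the rotated tiling is, by
  -- definition, a step of `T` read backwards.
  rotate : Tiling _<_ n → Tiling (flip _<_) n
  rotate T = record
    { isDenseOrder = flipped isDenseOrder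
    ; left = right ; right = left ; bottom = top ; top = bottom
    ; left<right = left<right ; bottom<top = bottom<top
    ; separated = λ p q r s → separated q p s r
    ; covered = λ p q r s → let z , (h , h′) , (v , v′) = covered q p s r in z , (h′ , h) , (v′ , v)
    ; noneUpperRight = λ p q → noneUpperRight p q
    } where open Tiling T

-- Straightening paths

module _ {a ℓ} {A : Set a} {_<_ : Rel A ℓ} {n : ℕ} (T : Tiling _<_ n) where
  open Tiling T

  -- Four cases for the lower left corner of `z` against the upper right corner of `x`. Beyond it in
  -- both directions is excluded by `noneUpperRight`; beyond it in neither makes the interiors
  -- overlap, although `z` starts higher than `x`. The other two cases are steps.
  right-up : ∀ {x y z} → Right x y → Up y z → Step x z
  right-up {x} {y} {z} (rx≤ly , bx<ty , _) (ty≤bz , ly<rz , _)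
    with bottom z <? top x | left z <? right x
  ... | no  tx≤bz | no  rx≤lz = ⊥-elim (noneUpperRight rx≤lz tx≤bz)
  ... | no  tx≤bz | yes lz<rx = inj₂ (tx≤bz , <-trans (left<right x) (≤-<-trans rx≤ly ly<rz) , lz<rx)
  ... | yes bz<tx | no  rx≤lz = inj₁ (rx≤lz , <-trans (<-≤-trans bx<ty ty≤bz) (bottom<top z) , bz<tx)
  ... | yes bz<tx | yes lz<rx = ⊥-elim (irrefl (cong bottom x≡z) bx<bz)
    where
    bx<bz = <-≤-trans bx<ty ty≤bz
    x≡z   = separated (<-trans (left<right x) (≤-<-trans rx≤ly ly<rz)) lz<rx
                      (<-trans bx<bz (bottom<top z)) bz<tx

  right⁺⇒≤ : ∀ {x y} → Right⁺ x y → right x ≤ left y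
  right⁺⇒≤ [ rx≤ly , _ ]              = rx≤ly
  right⁺⇒≤ {x} (_∷_ {y = z} (rx≤lz , _) zs) = ≤-trans rx≤lz (≤-trans (<⇒≤ (left<right z)) (right⁺⇒≤ zs))

  -- The right step absorbs up steps one by one; once the composite is itself an up step, the whole
  -- remaining path goes up.
  right-up⁺ : ∀ {x y z} → Right x y → Up⁺ y z → Right⁺ x z ⊎ Up⁺ x z
  right-up⁺ r [ u ] with right-up r u
  ... | inj₁ r′ = inj₁ [ r′ ]
  ... | inj₂ u′ = inj₂ [ u′ ]
  right-up⁺ r (u ∷ us) with right-up r u
  ... | inj₁ r′ = right-up⁺ r′ us
  ... | inj₂ u′ = inj₂ (u′ ∷ us)

module _ {a ℓ} {A : Set a} {_<_ : Rel A ℓ} {n : ℕ} (T : Tiling _<_ n) where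
  open Tiling T

  straighten : ∀ {x y} → Step⁺ x y → Right⁺ x y ⊎ Up⁺ x y
  straighten [ inj₁ r ] = inj₁ [ r ]
  straighten [ inj₂ u ] = inj₂ [ u ]
  straighten (s ∷ ss) with s | straighten ss
  ... | inj₁ r | inj₁ rs = inj₁ (r ∷ rs)
  ... | inj₁ r | inj₂ us = right-up⁺ T r us
  -- Transposition exchanges `Right` and `Up` definitionally.
  ... | inj₂ u | inj₁ rs = swap (right-up⁺ (transpose T) u rs)
  ... | inj₂ u | inj₂ us = inj₂ (u ∷ us)

  step⁺-acyclic : ∀ {x} → ¬ Step⁺ x x
  step⁺-acyclic {x} c with straighten c
  ... | inj₁ rs = right⁺⇒≤ T rs (left<right x)
  ... | inj₂ us = right⁺⇒≤ (transpose T) us (bottom<top x)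

  step⁺-step*-acyclic : ∀ {x y} → Step⁺ x y → ¬ Step* y x
  step⁺-step*-acyclic xs ε        = step⁺-acyclic xs
  step⁺-step*-acyclic xs (s ◅ ss) = step⁺-step*-acyclic (xs ++ [ s ]) ss

  -- Again four cases, now for the upper right corner of `w` against the lower left corner of `x`;
  -- overlapping interiors give equality.
  precedes : ∀ {w x} → left w < right x → top w ≤ top x → w ≡ x ⊎ Step w x
  precedes {w} {x} lw<rx tw≤tx with left x <? right w | bottom x <? top w
  ... | no  rw≤lx | no  tw≤bx = ⊥-elim (noneUpperRight rw≤lx tw≤bx)
  ... | no  rw≤lx | yes bx<tw = inj₂ (inj₁ (rw≤lx , <-≤-trans (bottom<top w) tw≤tx , bx<tw))
  ... | yes lx<rw | no  tw≤bx = inj₂ (inj₂ (tw≤bx , lw<rx , lx<rw))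
  ... | yes lx<rw | yes bx<tw = inj₁ (separated lw<rx lx<rw (<-≤-trans (bottom<top w) tw≤tx) bx<tw)

-- Aligned contacts are covers

module _ {a ℓ} {A : Set a} {_<_ : Rel A ℓ} {n : ℕ} (T : Tiling _<_ n) where
  open Tiling T

  module _ {x y : Fin n} (tx≡by : top x ≡ bottom y) where

    -- Only the last rectangle before `y` matters: its top is no higher than that of `x` and it
    -- starts left of the right side of `x`, so `precedes` applies.
    up⁺⇒step* : right y ≤ right x → ∀ {z} → Up⁺ z y → Step* z x
    up⁺⇒step* ry≤rx [ tz≤by , lz<ry , _ ]
      with precedes T (<-≤-trans lz<ry ry≤rx) (subst (top _ ≤_) (sym tx≡by) tz≤by)
    ... | inj₁ refl = ε
    ... | inj₂ s    = s ◅ ε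
    up⁺⇒step* ry≤rx (u ∷ us) = inj₂ u ◅ up⁺⇒step* ry≤rx us

    -- The half-turned counterpart. Since a half-turn reverses paths, only the first step is treated
    -- in the rotated tiling.
    up⁺⇒step*′ : left y ≤ left x → ∀ {z} → Up⁺ x z → Step* y z
    up⁺⇒step*′ ly≤lx us = go us
      where
      first : ∀ {w} → Up x w → Step* y w
      first (tx≤bw , lx<rw , _)
        with precedes (rotate T) (≤-<-trans ly≤lx lx<rw) (subst (_≤ bottom _) tx≡by tx≤bw)
      ... | inj₁ refl = ε
      ... | inj₂ s    = s ◅ ε

      go : ∀ {z} → Up⁺ x z → Step* y z
      go [ u ]    = first u
      go (u ∷ us) = first u ◅◅ up⁺⇒star us
        where
        up⁺⇒star : ∀ {v w} → Up⁺ v w → Step* v w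
        up⁺⇒star [ u ]    = inj₂ u ◅ ε
        up⁺⇒star (u ∷ us) = inj₂ u ◅ up⁺⇒star us

    -- Both halves are straightened. If the second goes up, `z` reaches `x`; if the first goes up,
    -- `y` reaches `z`; either closes a cycle. If both go right, `y` lies entirely to the right of
    -- `x`, against the overlap.
    upAligned⇒nothingBetween : left y < right x → left y ≤ left x → right y ≤ right x →
                               ∀ {z} → Step⁺ x z → Step⁺ z y → ⊥
    upAligned⇒nothingBetween ly<rx ly≤lx ry≤rx {z} xz zy with straighten T xz | straighten T zy
    ... | _       | inj₂ us  = step⁺-step*-acyclic T xz (up⁺⇒step* ry≤rx us)
    ... | inj₂ us | inj₁ _   = step⁺-step*-acyclic T zy (up⁺⇒step*′ ly≤lx us)
    ... | inj₁ rs | inj₁ rs′ =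
      ≤-trans (right⁺⇒≤ T rs) (≤-trans (<⇒≤ (left<right z)) (right⁺⇒≤ T rs′)) ly<rx

-- Rectangles at the corners of a horizontal contact

module _ {a ℓ} {A : Set a} {_<_ : Rel A ℓ} {n : ℕ} (T : Tiling _<_ n) where
  open Tiling T
  private module Flipped = IsDenseOrder (flipped isDenseOrder)

  module _ {x y : Fin n} (tx≡by : top x ≡ bottom y) where

    -- Some `z` covers a point at abscissa `u` just above the contact line. No bottom edge lies
    -- strictly above the line and up to that point, so `z` does not start above the line; starting
    -- below it would make `z` overlap `x`.
    above : ∀ {u} → left x < u → u < right x →
            ∃[ z ] ((left z ≤ u × u ≤ right z) × top x ≡ bottom z)
    above {u} lx<u u<rx with Flipped.approach bottom (bottom<top y)
    ... | v , v<ty , by<v , avoids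
        with covered {x} {x} {y} {y} {u} {v} (<⇒≤ lx<u) (<⇒≤ u<rx) (<⇒≤ by<v) (<⇒≤ v<ty)
    ...   | z , (lz≤u , u≤rz) , (bz≤v , v≤tz) =
            z , (lz≤u , u≤rz) , ≤-antisym tx≤bz (subst (bottom z ≤_) (sym tx≡by) (avoids z bz≤v))
      where
      tx<tz : top x < top z
      tx<tz = subst (_< top z) (sym tx≡by) (<-≤-trans by<v v≤tz)
      tx≤bz : top x ≤ bottom z
      tx≤bz bz<tx = irrefl (cong top x≡z) tx<tz
        where x≡z = separated (<-≤-trans lx<u u≤rz) (≤-<-trans lz≤u u<rx)
                              (<-trans (bottom<top x) tx<tz) bz<tx


  -- With `u` so close to `left y` that no right edge lies in between, the rectangle on `x` at `u`
  -- must reach `y`, and disjointness stops it there.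
  cornerLeft : ∀ {x y} → UpTouch x y → left x < left y → ∃[ z ] (UpTouch x z × RightTouch z y)
  cornerLeft {x} {y} ((_ , _ , ly<rx) , tx≡by) lx<ly with approach right lx<ly
  ... | u , lx<u , u<ly , avoids with above tx≡by lx<u (<-trans u<ly ly<rx)
  ...   | z , (lz≤u , u≤rz) , tx≡bz =
          z , ((≤-reflexive tx≡bz , <-≤-trans lx<u u≤rz , <-trans lz<ly ly<rx) , tx≡bz)
            , ((≤-reflexive rz≡ly , bz<ty , by<tz) , rz≡ly)
    where
    lz<ly : left z < left y
    lz<ly = ≤-<-trans lz≤u u<ly
    by<tz : bottom y < top z
    by<tz = subst (_< top z) (trans (sym tx≡bz) tx≡by) (bottom<top z)
    bz<ty : bottom z < top y
    bz<ty = subst (_< top y) (trans (sym tx≡by) tx≡bz) (bottom<top y)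
    rz≤ly : right z ≤ left y
    rz≤ly ly<rz = irrefl (cong left (separated (<-trans lz<ly (left<right y)) ly<rz bz<ty by<tz)) lz<ly
    rz≡ly : right z ≡ left y
    rz≡ly = ≤-antisym rz≤ly (avoids z u≤rz)

  -- The same device on the other side: no left edge lies strictly right of `right y` and up to `u`.
  overhangRight : ∀ {x y} → UpTouch x y → right y < right x →
                  ∃[ z ] (left z ≡ right y × top x ≡ bottom z)
  overhangRight {x} {y} ((_ , lx<ry , _) , tx≡by) ry<rx with Flipped.approach left ry<rx
  ... | u , u<rx , ry<u , avoids with above tx≡by (<-trans lx<ry ry<u) u<rx
  ...   | z , (lz≤u , u≤rz) , tx≡bz = z , ≤-antisym (avoids z lz≤u) ry≤lz , tx≡bz
    where
    ry<rz : right y < right z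
    ry<rz = <-≤-trans ry<u u≤rz
    by<tz : bottom y < top z
    by<tz = subst (_< top z) (trans (sym tx≡bz) tx≡by) (bottom<top z)
    bz<ty : bottom z < top y
    bz<ty = subst (_< top y) (trans (sym tx≡by) tx≡bz) (bottom<top y)
    ry≤lz : right y ≤ left z
    ry≤lz lz<ry = irrefl (cong right (sym (separated lz<ry (<-trans (left<right y) ry<rz) bz<ty by<tz))) ry<rz

-- Unrefined contacts are aligned

module _ {a ℓ} {A : Set a} {_<_ : Rel A ℓ} {n : ℕ} (T : Tiling _<_ n) where
  open Tiling T

  -- `z` sits on `x` and starts where `y` ends; `w` hangs below `y` and ends where `x` starts. So
  -- `z` lies to the upper right of `w`.
  noDoubleOverhang : ∀ {x y} → UpTouch x y → left y < left x → right y < right x → ⊥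
  noDoubleOverhang {x} {y} (u@(_ , lx<ry , _) , tx≡by) ly<lx ry<rx
    with overhangRight T (u , tx≡by) ry<rx | overhangRight (rotate T) (u , sym tx≡by) ly<lx
  ... | z , lz≡ry , tx≡bz | w , rw≡lx , by≡tw = noneUpperRight
    (subst₂ _≤_ (sym rw≡lx) (sym lz≡ry) (<⇒≤ lx<ry))
    (≤-reflexive (trans (sym by≡tw) (trans (sym tx≡by) tx≡bz)))

  unrefined⇒upAligned : ∀ {x y} → UpTouch x y → (∀ {z} → Touch x z → Touch z y → ⊥) → UpAligned x y
  unrefined⇒upAligned {x} {y} (u , tx≡by) none = (ly≤lx , ry≤rx) , oneEqual
    where
    ly≤lx : left y ≤ left x
    ly≤lx lx<ly = let _ , up , right = cornerLeft T (u , tx≡by) lx<ly in none (inj₂ up) (inj₁ right)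

    ry≤rx : right y ≤ right x
    -- After a half-turn `x` sits on `y`; the rectangle found hangs below `y` and touches the right
    -- side of `x`.
    ry≤rx rx<ry = let _ , (up , by≡tz) , (right , lz≡rx) = cornerLeft (rotate T) (u , sym tx≡by) rx<ry
                  in none (inj₁ (right , sym lz≡rx)) (inj₂ (up , sym by≡tz))

    oneEqual : left x ≡ left y ⊎ right x ≡ right y
    oneEqual with ≤⇒<⊎≡ ly≤lx | ≤⇒<⊎≡ ry≤rx
    ... | inj₂ ly≡lx | _          = inj₁ (sym ly≡lx)
    ... | inj₁ _     | inj₂ ry≡rx = inj₂ (sym ry≡rx)
    ... | inj₁ ly<lx | inj₁ ry<rx = ⊥-elim (noDoubleOverhang (u , tx≡by) ly<lx ry<rx)

module _ {a ℓ} {A : Set a} {_<_ : Rel A ℓ} {n : ℕ} (T : Tiling _<_ n) where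
  open Tiling T

  -- One shared end already makes the projections overlap, so corner equalities suffice for contact.
  upAligned⇒upTouch : ∀ {x y} → top x ≡ bottom y → UpAligned x y → UpTouch x y
  upAligned⇒upTouch {x} {y} tx≡by ((ly≤lx , _) , one≡) =
    (≤-reflexive tx≡by , lx<ry one≡ , ≤-<-trans ly≤lx (left<right x)) , tx≡by
    where
    lx<ry : left x ≡ left y ⊎ right x ≡ right y → left x < right y
    lx<ry (inj₁ lx≡ly) = subst (_< right y) (sym lx≡ly) (left<right y)
    lx<ry (inj₂ rx≡ry) = subst (left x <_) rx≡ry (left<right x)

module _ {a ℓ} {A : Set a} {_<_ : Rel A ℓ} {n : ℕ} (T : Tiling _<_ n) where
  open Tiling T

  Aligned : Rel (Fin n) (a ⊔ ℓ)
  Aligned x y = (RightTouch x y × RightAligned x y) ⊎ (UpTouch x y × UpAligned x y)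

  rightAligned⇒aligned : ∀ {x y} → right x ≡ left y → RightAligned x y → Aligned x y
  rightAligned⇒aligned rx≡ly r = inj₁ (upAligned⇒upTouch (transpose T) rx≡ly r , r)

  upAligned⇒aligned : ∀ {x y} → top x ≡ bottom y → UpAligned x y → Aligned x y
  upAligned⇒aligned tx≡by u = inj₂ (upAligned⇒upTouch T tx≡by u , u)

  unrefined⇒aligned : ∀ {x y} → Touch x y → (∀ {z} → Touch x z → Touch z y → ⊥) → Aligned x y
  unrefined⇒aligned (inj₁ r) none =
    inj₁ (r , unrefined⇒upAligned (transpose T) r (λ p q → none (swap p) (swap q)))
  unrefined⇒aligned (inj₂ u) none = inj₂ (u , unrefined⇒upAligned T u none)

  aligned⇒nothingBetween : ∀ {x y z} → Aligned x y → Step⁺ x z → Step⁺ z y → ⊥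
  aligned⇒nothingBetween (inj₁ (((_ , _ , by<tx) , rx≡ly) , (by≤bx , ty≤tx) , _)) xz zy =
    upAligned⇒nothingBetween (transpose T) rx≡ly by<tx by≤bx ty≤tx (swap⁺ xz) (swap⁺ zy)
    where
    swap⁺ : ∀ {x y} → Step⁺ x y → Tiling.Step⁺ (transpose T) x y
    swap⁺ [ s ]    = [ swap s ]
    swap⁺ (s ∷ ss) = swap s ∷ swap⁺ ss
  aligned⇒nothingBetween (inj₂ (((_ , _ , ly<rx) , tx≡by) , (ly≤lx , ry≤rx) , _)) =
    upAligned⇒nothingBetween T tx≡by ly<rx ly≤lx ry≤rx

-- From the plane to the tiling

module _ {c ℓ} (K : OrderedField c ℓ) where
  open OrderedField K hiding (_≤_)
  private
    open module F = IsStrictTotalOrder isStrictTotalOrder using (compare; irrefl)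
    open module R = CommutativeRing commutativeRing using (+-identityʳ; +-comm; +-assoc; distribˡ; *-identityʳ)

  +-mono-< : ∀ {x y z w} → x < y → z < w → x + z < y + w
  +-mono-< {x} {y} {z} {w} x<y z<w =
    F.trans (+-monoʳ-< x z<w) (subst₂ _<_ (+-comm w x) (+-comm w y) (+-monoʳ-< w x<y))

  double-pos : ∀ {x} → 0# < x → 0# < x + x
  double-pos {x} 0<x = subst (_< x + x) (+-identityʳ 0#) (+-mono-< 0<x 0<x)

  double-neg : ∀ {x} → x < 0# → x + x < 0#
  double-neg {x} x<0 = subst (x + x <_) (+-identityʳ 0#) (+-mono-< x<0 x<0)

  -- Doubling preserves either sign, so `0# < 1#` need not be established first.
  1+1≢0 : 1# + 1# ≢ 0#
  1+1≢0 2≡0 with compare 0# 1#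
  ... | tri< 0<1 _ _ = irrefl (sym 2≡0) (double-pos 0<1)
  ... | tri≈ _ 0≡1 _ = 0≢1 0≡1
  ... | tri> _ _ 1<0 = irrefl 2≡0 (double-neg 1<0)

  half : ∀ d → ∃[ e ] e + e ≡ d
  half d = let h , 2h≡1 = inverse (1# + 1#) 1+1≢0 in d * h , (begin
    d * h + d * h          ≡⟨ distribˡ d h h ⟨
    d * (h + h)            ≡⟨ cong (λ k → d * (k + k)) (R.*-identityˡ h) ⟨
    d * (1# * h + 1# * h)  ≡⟨ cong (d *_) (R.distribʳ h 1# 1#) ⟨
    d * ((1# + 1#) * h)    ≡⟨ cong (d *_) 2h≡1 ⟩
    d * 1#                 ≡⟨ *-identityʳ d ⟩
    d                      ∎)
    where open ≡-Reasoning

  +-minus : ∀ x y → x + (y - x) ≡ y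
  +-minus x y = begin
    x + (y - x)    ≡⟨ +-comm x (y - x) ⟩
    y - x + x      ≡⟨ +-assoc y (- x) x ⟩
    y + (- x + x)  ≡⟨ cong (y +_) (R.-‿inverseˡ x) ⟩
    y + 0#         ≡⟨ +-identityʳ y ⟩
    y              ∎
    where open ≡-Reasoning

  <-dense : ∀ {x y} → x < y → ∃[ z ] (x < z × z < y)
  <-dense {x} {y} x<y with half (y - x)
  ... | e , 2e≡y-x = x + e , subst (_< x + e) (+-identityʳ x) (+-monoʳ-< x 0<e) ,
                     subst (x + e <_) x+2e≡y (+-monoʳ-< x (subst (_< e + e) (+-identityʳ e) (+-monoʳ-< e 0<e)))
    where
    x+2e≡y : x + (e + e) ≡ y
    x+2e≡y = trans (cong (x +_) 2e≡y-x) (+-minus x y)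
    0<e : 0# < e
    0<e with compare 0# e
    ... | tri< 0<e _ _  = 0<e
    ... | tri≈ _ refl _ = ⊥-elim (irrefl (trans (sym (+-identityʳ x)) (trans (cong (x +_) (sym (+-identityʳ 0#))) x+2e≡y)) x<y)
    ... | tri> _ _ e<0  = ⊥-elim (F.asym x<y
      (subst₂ _<_ x+2e≡y (+-identityʳ x) (+-monoʳ-< x (double-neg e<0))))

  <-isDenseOrder : IsDenseOrder _<_
  <-isDenseOrder = record { isStrictTotalOrder = isStrictTotalOrder ; dense = <-dense }

module _ {c ℓ} (K : OrderedField c ℓ) where
  open OrderedField K using (_+_; _<_) renaming (_≤_ to _≤ᶠ_)
  open Plane K
  open IsDenseOrder (<-isDenseOrder K)

  ≤⇒≤ᶠ : ∀ {x y} → x ≤ y → x ≤ᶠ y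
  ≤⇒≤ᶠ = ≤⇒<⊎≡

  ≤ᶠ⇒≤ : ∀ {x y} → x ≤ᶠ y → x ≤ y
  ≤ᶠ⇒≤ (inj₁ x<y) = <⇒≤ x<y
  ≤ᶠ⇒≤ (inj₂ x≡y) = ≤-reflexive x≡y

  subst-bounds : ∀ {l l′ r r′ x} → l ≡ l′ → r ≡ r′ → l ≤ᶠ x × x ≤ᶠ r → l′ ≤ᶠ x × x ≤ᶠ r′
  subst-bounds refl refl bounds = bounds

  module _ {n : ℕ} (D : DiagonalRectangulation n) where
    open DiagonalRectangulation D
    open AdjacencyPoset D

    inSquare : ∀ i {p} → p ∈ closed (rect i) → p ∈ square n
    inSquare i p∈i = proj₁ covers (i , p∈i)

    lowerLeft∈ : ∀ R → lowerLeft R ∈ closed R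
    lowerLeft∈ R = (inj₂ refl , inj₁ (left<right R)) , (inj₂ refl , inj₁ (bottom<top R))

    upperRight∈ : ∀ R → upperRight R ∈ closed R
    upperRight∈ R = (inj₁ (left<right R) , inj₂ refl) , (inj₁ (bottom<top R) , inj₂ refl)

    interiors-meet⇒≡ : ∀ {i j} → left (rect i) < right (rect j) → left (rect j) < right (rect i) →
                       bottom (rect i) < top (rect j) → bottom (rect j) < top (rect i) → i ≡ j
    interiors-meet⇒≡ {i} {j} p q r s with i ≟ᶠ j
    ... | yes i≡j = i≡j
    ... | no  i≢j =
      let u , uᵢ , uⱼ = intervals-meet (left<right (rect i)) (left<right (rect j)) p q
          v , vᵢ , vⱼ = intervals-meet (bottom<top (rect i)) (bottom<top (rect j)) r s
      in ⊥-elim (interiorDisjoint i≢j ((u , v) , (uᵢ , vᵢ) , (uⱼ , vⱼ)))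

    -- Diagonal points inside the two rectangles would have strictly different coordinate sums, but
    -- both sums equal `fromℕ n`.
    diagonal-separates : ∀ {i j} → right (rect i) ≤ left (rect j) → top (rect i) ≤ bottom (rect j) → ⊥
    diagonal-separates {i} {j} ri≤lj ti≤bj with meetsDiagonal i | meetsDiagonal j
    ... | _ , (_ , u+v≡n) , (_ , u<ri) , (_ , v<ti)
        | _ , (_ , u′+v′≡n) , (lj<u′ , _) , (bj<v′ , _) =
      irrefl (trans u+v≡n (sym u′+v′≡n))
        (+-mono-< K (<-trans u<ri (≤-<-trans ri≤lj lj<u′)) (<-trans v<ti (≤-<-trans ti≤bj bj<v′)))

    tiling : Tiling _<_ n
    tiling = record
      { isDenseOrder = <-isDenseOrder K
      ; left = left ∘ rect ; right = right ∘ rect ; bottom = bottom ∘ rect ; top = top ∘ rect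
      ; left<right = left<right ∘ rect ; bottom<top = bottom<top ∘ rect
      ; separated = interiors-meet⇒≡
      ; covered = λ {i} {j} {k} {m} li≤u u≤rj bk≤v v≤tm →
          let (0≤li , _) , _ = inSquare i (lowerLeft∈ (rect i))
              (_ , rj≤n) , _ = inSquare j (upperRight∈ (rect j))
              _ , (0≤bk , _) = inSquare k (lowerLeft∈ (rect k))
              _ , (_ , tm≤n) = inSquare m (upperRight∈ (rect m))
              z , (lz≤u , u≤rz) , (bz≤v , v≤tz) = proj₂ covers
                ( (≤⇒≤ᶠ (≤-trans (≤ᶠ⇒≤ 0≤li) li≤u) , ≤⇒≤ᶠ (≤-trans u≤rj (≤ᶠ⇒≤ rj≤n)))
                , (≤⇒≤ᶠ (≤-trans (≤ᶠ⇒≤ 0≤bk) bk≤v) , ≤⇒≤ᶠ (≤-trans v≤tm (≤ᶠ⇒≤ tm≤n))) )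
          in z , (≤ᶠ⇒≤ lz≤u , ≤ᶠ⇒≤ u≤rz) , (≤ᶠ⇒≤ bz≤v , ≤ᶠ⇒≤ v≤tz)
      ; noneUpperRight = diagonal-separates
      }

    -- The adjacency poset in terms of contacts

    open Tiling tiling using (Touch; Step; Step⁺)

    adjacent⇒touch : ∀ {x y} → Adjacent x y → Touch x y
    adjacent⇒touch (_ , inj₁ (v≡by , ly<u , u<ry) , inj₁ (v≡tx , lx<u , u<rx)) =
      inj₂ ((≤-reflexive tx≡by , <-trans lx<u u<ry , <-trans ly<u u<rx) , tx≡by)
      where tx≡by = trans (sym v≡tx) v≡by
    adjacent⇒touch (_ , inj₂ (u≡ly , by<v , v<ty) , inj₂ (u≡rx , bx<v , v<tx)) =
      inj₁ ((≤-reflexive rx≡ly , <-trans bx<v v<ty , <-trans by<v v<tx) , rx≡ly)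
      where rx≡ly = trans (sym u≡rx) u≡ly
    -- Perpendicular sides meeting in their relative interiors make the two interiors overlap, so
    -- `x` equals `y`; yet the meeting point is on the bottom line of `y` and strictly above that of
    -- `x`.
    adjacent⇒touch {x} {y} (_ , inj₁ (refl , ly<u , u<ry) , inj₂ (refl , bx<v , v<tx)) =
      ⊥-elim (irrefl (cong (bottom ∘ rect) x≡y) bx<v)
      where x≡y = interiors-meet⇒≡ (<-trans (left<right (rect x)) u<ry) ly<u
                                   (<-trans bx<v (bottom<top (rect y))) v<tx
    adjacent⇒touch {x} {y} (_ , inj₂ (refl , by<v , v<ty) , inj₁ (refl , lx<u , u<rx)) =
      ⊥-elim (irrefl (cong (left ∘ rect) x≡y) lx<u)
      where x≡y = interiors-meet⇒≡ (<-trans lx<u (left<right (rect y))) u<rx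
                                   (<-trans (bottom<top (rect x)) v<ty) by<v

    touch⇒adjacent : ∀ {x y} → Touch x y → Adjacent x y
    touch⇒adjacent {x} {y} (inj₁ ((_ , bx<ty , by<tx) , rx≡ly)) =
      let v , vₓ , vᵧ = intervals-meet (bottom<top (rect x)) (bottom<top (rect y)) bx<ty by<tx
      in (right (rect x) , v) , inj₂ (rx≡ly , vᵧ) , inj₂ (refl , vₓ)
    touch⇒adjacent {x} {y} (inj₂ ((_ , lx<ry , ly<rx) , tx≡by)) =
      let u , uₓ , uᵧ = intervals-meet (left<right (rect x)) (left<right (rect y)) lx<ry ly<rx
      in (u , top (rect x)) , inj₁ (tx≡by , uᵧ) , inj₁ (refl , uₓ)

    touch⇒step : ∀ {x y} → Touch x y → Step x y
    touch⇒step = map⊎ proj₁ proj₁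

    touch⇒<ₚ : ∀ {x y} → Touch x y → x <ₚ y
    touch⇒<ₚ t = touch⇒adjacent t ◅ ε , λ { refl → step⁺-acyclic tiling [ touch⇒step t ] }

    <ₚ⇒step⁺ : ∀ {x y} → x <ₚ y → Step⁺ x y
    <ₚ⇒step⁺ (ε , x≢x)      = ⊥-elim (x≢x refl)
    <ₚ⇒step⁺ (s ◅ ss , _)   = go s ss
      where
      go : ∀ {x y z} → Adjacent x y → Star Adjacent y z → Step⁺ x z
      go s ε        = [ touch⇒step (adjacent⇒touch s) ]
      go s (t ◅ ts) = touch⇒step (adjacent⇒touch s) ∷ go t ts

    -- If the first adjacency of a path ended anywhere but at `y`, its end would lie strictly
    -- between.
    ⋖ₚ⇒touch : ∀ {x y} → x ⋖ₚ y → Touch x y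
    ⋖ₚ⇒touch ((ε , x≢x) , _) = ⊥-elim (x≢x refl)
    ⋖ₚ⇒touch {x} {y} ((_◅_ {j = z} s ss , _) , none) with z ≟ᶠ y
    ... | yes refl = adjacent⇒touch s
    ... | no  z≢y  = ⊥-elim (none (z , touch⇒<ₚ (adjacent⇒touch s) , (ss , z≢y)))

    ⋖ₚ⇒aligned : ∀ {x y} → x ⋖ₚ y → Aligned tiling x y
    ⋖ₚ⇒aligned x⋖y@(_ , none) = unrefined⇒aligned tiling (⋖ₚ⇒touch x⋖y)
      (λ {z} xz zy → none (z , touch⇒<ₚ xz , touch⇒<ₚ zy))

    aligned⇒⋖ₚ : ∀ {x y} → Aligned tiling x y → x ⋖ₚ y
    aligned⇒⋖ₚ a = touch⇒<ₚ (map⊎ proj₁ proj₁ a) ,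
      λ (_ , xz , zy) → aligned⇒nothingBetween tiling a (<ₚ⇒step⁺ xz) (<ₚ⇒step⁺ zy)

    -- The six configurations

    Configuration : Fin n → Fin n → Set (c ⊔ ℓ)
    Configuration x y =
      let X = rect x ; Y = rect y in
        (upperLeft X ≡ lowerLeft Y × right Y < right X)
      ⊎ (lowerRight X ≡ lowerLeft Y × top Y < top X)
      ⊎ (topSide X ≐ bottomSide Y)
      ⊎ (rightSide X ≐ leftSide Y)
      ⊎ (upperRight X ≡ lowerRight Y × left Y < left X)
      ⊎ (upperRight X ≡ upperLeft Y × bottom Y < bottom X)

    -- The shared end and the strictness of the other inequality select a corner configuration; two
    -- shared ends identify whole sides.
    aligned⇒configuration : ∀ {x y} → Aligned tiling x y → Configuration x y
    aligned⇒configuration {x} {y} (inj₁ ((_ , rx≡ly) , (by≤bx , ty≤tx) , one≡)) = go one≡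
      where
      opposite : bottom (rect x) ≡ bottom (rect y) → top (rect x) ≡ top (rect y) → Configuration x y
      opposite bx≡by tx≡ty = inj₂ (inj₂ (inj₂ (inj₁
        ( (λ (u≡rx , v) → trans u≡rx rx≡ly , subst-bounds bx≡by tx≡ty v)
        , (λ (u≡ly , v) → trans u≡ly (sym rx≡ly) , subst-bounds (sym bx≡by) (sym tx≡ty) v) ))))

      go : bottom (rect x) ≡ bottom (rect y) ⊎ top (rect x) ≡ top (rect y) → Configuration x y
      go (inj₁ bx≡by) with ≤⇒<⊎≡ ty≤tx
      ... | inj₁ ty<tx = inj₂ (inj₁ (cong₂ _,_ rx≡ly bx≡by , ty<tx))
      ... | inj₂ ty≡tx = opposite bx≡by (sym ty≡tx)
      go (inj₂ tx≡ty) with ≤⇒<⊎≡ by≤bx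
      ... | inj₁ by<bx = inj₂ (inj₂ (inj₂ (inj₂ (inj₂ (cong₂ _,_ rx≡ly tx≡ty , by<bx)))))
      ... | inj₂ by≡bx = opposite (sym by≡bx) tx≡ty
    aligned⇒configuration {x} {y} (inj₂ ((_ , tx≡by) , (ly≤lx , ry≤rx) , one≡)) = go one≡
      where
      opposite : left (rect x) ≡ left (rect y) → right (rect x) ≡ right (rect y) → Configuration x y
      opposite lx≡ly rx≡ry = inj₂ (inj₂ (inj₁
        ( (λ (v≡tx , u) → trans v≡tx tx≡by , subst-bounds lx≡ly rx≡ry u)
        , (λ (v≡by , u) → trans v≡by (sym tx≡by) , subst-bounds (sym lx≡ly) (sym rx≡ry) u) )))

      go : left (rect x) ≡ left (rect y) ⊎ right (rect x) ≡ right (rect y) → Configuration x y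
      go (inj₁ lx≡ly) with ≤⇒<⊎≡ ry≤rx
      ... | inj₁ ry<rx = inj₁ (cong₂ _,_ lx≡ly tx≡by , ry<rx)
      ... | inj₂ ry≡rx = opposite lx≡ly (sym ry≡rx)
      go (inj₂ rx≡ry) with ≤⇒<⊎≡ ly≤lx
      ... | inj₁ ly<lx = inj₂ (inj₂ (inj₂ (inj₂ (inj₁ (cong₂ _,_ rx≡ry tx≡by , ly<lx)))))
      ... | inj₂ ly≡lx = opposite (sym ly≡lx) rx≡ry

    configuration⇒aligned : ∀ {x y} → Configuration x y → Aligned tiling x y
    configuration⇒aligned (inj₁ (ul≡ll , ry<rx)) =
      upAligned⇒aligned tiling (cong proj₂ ul≡ll)
        ((≤-reflexive (sym lx≡ly) , <⇒≤ ry<rx) , inj₁ lx≡ly)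
      where lx≡ly = cong proj₁ ul≡ll
    configuration⇒aligned (inj₂ (inj₁ (lr≡ll , ty<tx))) =
      rightAligned⇒aligned tiling (cong proj₁ lr≡ll)
        ((≤-reflexive (sym bx≡by) , <⇒≤ ty<tx) , inj₁ bx≡by)
      where bx≡by = cong proj₂ lr≡ll
    configuration⇒aligned {x} {y} (inj₂ (inj₂ (inj₁ (X⊆Y , Y⊆X)))) =
      -- Coordinates are recovered by testing the inclusions at the upper left corner of `x` and at
      -- the two lower corners of `y`.
      let v≡ , ly≤lx , _ = X⊆Y (refl , inj₂ refl , inj₁ (left<right (rect x)))
          _ , lx≤ly , _  = Y⊆X (refl , inj₂ refl , inj₁ (left<right (rect y)))
          _ , _ , ry≤rx  = Y⊆X (refl , inj₁ (left<right (rect y)) , inj₂ refl)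
      in upAligned⇒aligned tiling v≡
           ((≤ᶠ⇒≤ ly≤lx , ≤ᶠ⇒≤ ry≤rx) , inj₁ (≤-antisym (≤ᶠ⇒≤ lx≤ly) (≤ᶠ⇒≤ ly≤lx)))
    configuration⇒aligned {x} {y} (inj₂ (inj₂ (inj₂ (inj₁ (X⊆Y , Y⊆X))))) =
      let u≡ , by≤bx , _ = X⊆Y (refl , inj₂ refl , inj₁ (bottom<top (rect x)))
          _ , bx≤by , _  = Y⊆X (refl , inj₂ refl , inj₁ (bottom<top (rect y)))
          _ , _ , ty≤tx  = Y⊆X (refl , inj₁ (bottom<top (rect y)) , inj₂ refl)
      in rightAligned⇒aligned tiling u≡
           ((≤ᶠ⇒≤ by≤bx , ≤ᶠ⇒≤ ty≤tx) , inj₁ (≤-antisym (≤ᶠ⇒≤ bx≤by) (≤ᶠ⇒≤ by≤bx)))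
    configuration⇒aligned (inj₂ (inj₂ (inj₂ (inj₂ (inj₁ (ur≡lr , ly<lx)))))) =
      upAligned⇒aligned tiling (cong proj₂ ur≡lr)
        ((<⇒≤ ly<lx , ≤-reflexive (sym rx≡ry)) , inj₂ rx≡ry)
      where rx≡ry = cong proj₁ ur≡lr
    configuration⇒aligned (inj₂ (inj₂ (inj₂ (inj₂ (inj₂ (ur≡ul , by<bx)))))) =
      rightAligned⇒aligned tiling (cong proj₁ ur≡ul)
        ((<⇒≤ by<bx , ≤-reflexive (sym tx≡ty)) , inj₂ tx≡ty)
      where tx≡ty = cong proj₂ ur≡ul

theorem3p2 : {c ℓ : Level} (K : OrderedField c ℓ) →
  let open OrderedField K using (_<_)
      open Plane K
  in
  (n : ℕ) (D : DiagonalRectangulation n) →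
  let open DiagonalRectangulation D using (rect)
      open AdjacencyPoset D using (_⋖ₚ_)
  in
  (x y : Fin n) →
  let X = rect x
      Y = rect y
  in
  x ⋖ₚ y ⇔
    ( (upperLeft X ≡ lowerLeft Y × right Y < right X)
    ⊎ (lowerRight X ≡ lowerLeft Y × top Y < top X)
    ⊎ (topSide X ≐ bottomSide Y)
    ⊎ (rightSide X ≐ leftSide Y)
    ⊎ (upperRight X ≡ lowerRight Y × left Y < left X)
    ⊎ (upperRight X ≡ upperLeft Y × bottom Y < bottom X) )
theorem3p2 K n D x y =
  mk⇔ (aligned⇒configuration K D ∘ ⋖ₚ⇒aligned K D) (aligned⇒⋖ₚ K D ∘ configuration⇒aligned K D)
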